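{- Let $m\ge 1$ and $n\ge 4$ be integers with $(m,n)\neq(1,5)$. Then there exists a cop-win graph with exactly $m$ cycles of length $n$, and there exists a killer-win graph with exactly $m$ cycles of length $n$ (for the cop and killer game).
   Context: Graphs are finite, simple and undirected, not necessarily connected. Cycles of length $n$ are counted as (not necessarily induced) subgraphs isomorphic to $C_n$. The cop and killer game on a graph $G$ is the following perfect-information game. First the cop picks a starting vertex, then the killer picks a starting vertex different from the cop's. Then the players alternate turns, the cop moving first; on each turn the player must move to a vertex adjacent to her/his current vertex (staying put is not allowed; a player on a vertex with no neighbours simply remains there). If after a move of the cop she occupies the killer's vertex, the cop wins; if after a move of the killer he occupies the cop's vertex, the killer wins; if neither ever happens, the game is a stalemate. $G$ is cop-win if the cop has a strategy that guarantees she wins, killer-win if the killer has a strategy that guarantees he wins, and stalemate if neither is the case. -}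

module Defs where

open import Level using (0ℓ; suc)
open import Data.Fin.Base using (Fin; toℕ)
open import Data.List.Base using (List; []; _∷_)
open import Data.Nat.Base as ℕ using (ℕ; _≤_; _<_)
open import Data.Product.Base using (Σ; Σ-syntax; ∃; ∃-syntax; _×_; _,_; proj₁; proj₂; swap)
open import Data.Sum.Base using (_⊎_)
open import Function.Base using (_∘_; _on_; id)
open import Function.Bundles using (Bijection)
open import Function.Definitions using (Injective)
open import Relation.Binary.Bundles using (Setoid)
open import Relation.Binary.Core using (Rel; _⇒_; _⇔_)
open import Relation.Binary.Construct.Closure.Symmetric using (SymClosure)
open import Relation.Binary.Definitions using (Symmetric; Irreflexive; Decidable)
open import Relation.Binary.PropositionalEquality.Core using (_≡_; _≢_)
open import Relation.Binary.PropositionalEquality.Properties using (setoid)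
open import Relation.Nullary.Negation.Core using (¬_)
open import Relation.Unary using (Pred; _≐_)

------------------------------------------------------------------------
-- Graphs, subgraphs and cycles

record Graph : Set₁ where
  infix 4 _~_
  field
    order    : ℕ
    _~_      : Rel (Fin order) 0ℓ
    ~-sym    : Symmetric _~_
    ~-irrefl : Irreflexive _≡_ _~_
    _~?_     : Decidable _~_

  Vertex : Set
  Vertex = Fin order

-- Not necessarily induced.
record Subgraph (G : Graph) : Set₁ where
  open Graph G using (Vertex; _~_)
  field
    vertices : Pred Vertex 0ℓ
    edges    : Rel Vertex 0ℓ
    edge-sym : Symmetric edges
    edge⇒~   : edges ⇒ _~_
    endpoint : ∀ {u v} → edges u v → vertices u

open Subgraph

-- Adjacency in the cycle 0, 1, …, n ∸ 1, 0.  This is the simple graph Cₙ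
-- only when 3 ≤ n.
Next : ∀ n → Rel (Fin n) 0ℓ
Next n i j = toℕ j ≡ ℕ.suc (toℕ i) ⊎ (ℕ.suc (toℕ i) ≡ n × toℕ j ≡ 0)

CycleAdjacent : ∀ n → Rel (Fin n) 0ℓ
CycleAdjacent n = SymClosure (Next n)

-- An isomorphism from Cₙ onto H, given as an injection into the vertices
-- of G whose image is the vertex set of H.
record IsCycle {G : Graph} (n : ℕ) (H : Subgraph G) : Set where
  field
    φ           : Fin n → Graph.Vertex G
    φ-injective : Injective _≡_ _≡_ φ
    φ-image     : vertices H ≐ (λ v → ∃[ i ] φ i ≡ v)
    φ-adjacency : CycleAdjacent n ⇔ (edges H on φ)

-- Two cycles are the same when they have the same vertices and the same
-- edges; the choice of isomorphism with Cₙ is irrelevant.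
cycles : Graph → ℕ → Setoid (suc 0ℓ) 0ℓ
cycles G n = record
  { Carrier       = Σ (Subgraph G) (IsCycle n)
  ; _≈_           = λ (H , _) (K , _) →
                      vertices H ≐ vertices K × edges H ⇔ edges K
  ; isEquivalence = record
    { refl  = (id , id) , (id , id)
    ; sym   = λ (p , q) → swap p , swap q
    ; trans = λ ((p , p′) , (q , q′)) ((r , r′) , (s , s′)) →
                (r ∘ p , p′ ∘ r′) , (s ∘ q , q′ ∘ s′)
    }
  }

HasExactlyCycles : Graph → (m n : ℕ) → Set₁
HasExactlyCycles G m n = Bijection (setoid (Fin m)) (cycles G n)

------------------------------------------------------------------------
-- The cop and killer game

module Game (G : Graph) where
  open Graph G using (Vertex; _~_)

  Isolated : Pred Vertex 0ℓ
  Isolated u = ∀ v → ¬ u ~ v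

  Move : Rel Vertex 0ℓ
  Move u v = u ~ v ⊎ (Isolated u × v ≡ u)

  -- The positions (cop , killer) at the start of the previous rounds,
  -- latest first.  A round is a move of the cop followed by a move of the
  -- killer, so these also determine the positions in the middle of a round.
  History : Set
  History = List (Vertex × Vertex)

  record CopStrategy : Set where
    field
      start : Vertex
      move  : History → (c k : Vertex) → ∃ (Move c)

  -- When the killer moves, the history he sees includes the position at
  -- the start of the current round, and c is where the cop has just moved.
  record KillerStrategy : Set where
    field
      start : (c : Vertex) → Σ[ k ∈ Vertex ] k ≢ c
      move  : History → (c k : Vertex) → ∃ (Move k)

  -- The play is continued after a capture; only the first capture counts.
  module Play (σ : CopStrategy) (τ : KillerStrategy) where
    private
      module σ = CopStrategy σ
      module τ = KillerStrategy τ

    state : ℕ → History × Vertex × Vertex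
    state ℕ.zero    = [] , σ.start , proj₁ (τ.start σ.start)
    state (ℕ.suc t) =
      let h , c , k = state t
          h′ = (c , k) ∷ h
          c′ = proj₁ (σ.move h c k)
          k′ = proj₁ (τ.move h′ c′ k)
      in h′ , c′ , k′

    cop killer : ℕ → Vertex
    cop    t = proj₁ (proj₂ (state t))
    killer t = proj₂ (proj₂ (state t))

    CopCaptures KillerCaptures : Pred ℕ 0ℓ
    CopCaptures    t = cop (ℕ.suc t) ≡ killer t
    KillerCaptures t = killer (ℕ.suc t) ≡ cop (ℕ.suc t)

    CopWins KillerWins : Set
    CopWins    = ∃[ t ] CopCaptures t × (∀ s → s < t → ¬ KillerCaptures s)
    KillerWins = ∃[ t ] KillerCaptures t × (∀ s → s ≤ t → ¬ CopCaptures s)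

  IsCopWin : Set
  IsCopWin = ∃[ σ ] ∀ τ → Play.CopWins σ τ

  IsKillerWin : Set
  IsKillerWin = ∃[ τ ] ∀ σ → Play.KillerWins σ τ

open Game public using (IsCopWin; IsKillerWin)

-- Join a hub 0 to every vertex of a path 1, …, M.  The hub is adjacent to
-- everything, so the cop wins, and the cycles of length n are the hub together
-- with n - 1 consecutive vertices of the path: there are M - n + 2 of them.
-- Replacing the edge 0 – 1 by 1 – 3 turns 1 into an ear on the edge 2 – 3.  The
-- cycles that avoid 1 are unchanged, and exactly one passes through 1, namely
-- 0, 2, 1, 3, …, n - 1, so the count is still M - n + 2.  If M ≥ 5, the killer now
-- wins: he can reach a position behind the cop on the path, at an even distance,
-- and then drives her towards the end M.
-- With M = m + n - 2 this leaves, besides (1 , 5), the pairs (1 , 4) and (2 , 4),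
-- where m squares in a row with a common vertex are killer-win.
module Submission where

open import Defs
open import Data.Empty using (⊥)
open import Data.Fin.Base using (Fin; toℕ; fromℕ<; zero; suc)
import Data.Fin.Properties as Fin
open import Data.List.Base using (length)
open import Data.Nat.Base
open import Data.Nat.Divisibility using (divides; ∣m+n∣m⇒∣n; >⇒∤)
open import Data.Nat.DivMod
open import Data.Nat.Properties
open import Data.Nat.Tactic.RingSolver using (solve-∀)
open import Data.Product.Base using (Σ-syntax; ∃-syntax; _×_; _,_; proj₁; proj₂)
open import Data.Sum.Base using (_⊎_; inj₁; inj₂)
open import Function.Base using (_∘_; _on_; id)
open import Function.Definitions using (Injective)
open import Level using (0ℓ)
open import Relation.Binary.Bundles using (Setoid)
open import Relation.Binary.Construct.Closure.Symmetric using (SymClosure; fwd; bwd; gmap; fold; symmetric)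
open import Relation.Binary.Core using (Rel; _⇒_; _⇔_; _=[_]⇒_)
open import Relation.Binary.Definitions using (Decidable; tri<; tri≈; tri>)
open import Relation.Binary.PropositionalEquality
open import Relation.Nullary.Decidable
  using (Dec; yes; no; True; toWitness; from-yes; map′; ¬?; _×-dec_; _⊎-dec_; _→-dec_)
open import Relation.Nullary.Negation using (¬_; contradiction)
import Relation.Unary as U

-- Residues modulo `n`

%≢+% : ∀ n .{{_ : NonZero n}} i {k} → 0 < k → k < n → i % n ≢ (i + k) % n
%≢+% n i {k@(suc _)} 0<k k<n eq =
  >⇒∤ k<n (∣m+n∣m⇒∣n (divides ((i + k) / n) multiple) (divides (i / n) refl))
  where
  open ≡-Reasoning
  multiple : i / n * n + k ≡ (i + k) / n * n
  multiple = +-cancelˡ-≡ (i % n) _ _ (begin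
    i % n + (i / n * n + k)            ≡⟨ +-assoc (i % n) _ k ⟨
    i % n + i / n * n + k              ≡⟨ cong (_+ k) (m≡m%n+[m/n]*n i n) ⟨
    i + k                              ≡⟨ m≡m%n+[m/n]*n (i + k) n ⟩
    (i + k) % n + (i + k) / n * n      ≡⟨ cong (_+ (i + k) / n * n) eq ⟨
    i % n + (i + k) / n * n            ∎)

-- The two alternatives mirror those of `Next`, so that `Next-mod` can send consecutive naturals to
-- consecutive vertices of the cycle.
suc-% : ∀ i n .{{_ : NonZero n}} →
        suc i % n ≡ suc (i % n) ⊎ (suc (i % n) ≡ n × suc i % n ≡ 0)
suc-% i n = wrap (m≤n⇒m<n∨m≡n (m%n<n i n))
  where
  reduce : suc i % n ≡ suc (i % n) % n
  reduce = trans (cong (λ x → suc x % n) (m≡m%n+[m/n]*n i n)) ([m+kn]%n≡m%n (suc (i % n)) (i / n) n)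

  wrap : suc (i % n) < n ⊎ suc (i % n) ≡ n → suc i % n ≡ suc (i % n) ⊎ (suc (i % n) ≡ n × suc i % n ≡ 0)
  wrap (inj₁ below) = inj₁ (trans reduce (m<n⇒m%n≡m below))
  wrap (inj₂ wraps) = inj₂ (wraps , trans reduce (trans (cong (_% n) wraps) (n%n≡0 n)))

toℕ-mod : ∀ i n .{{_ : NonZero n}} → toℕ (i mod n) ≡ i % n
toℕ-mod i n = Fin.toℕ-fromℕ< (m%n<n i n)

mod-toℕ : ∀ {n} .{{_ : NonZero n}} (i : Fin n) → toℕ i mod n ≡ i
mod-toℕ {n} i = Fin.toℕ-injective (trans (toℕ-mod (toℕ i) n) (m<n⇒m%n≡m (Fin.toℕ<n i)))

mod-cong : ∀ {n} .{{_ : NonZero n}} i j → i % n ≡ j % n → i mod n ≡ j mod n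
mod-cong {n} i j eq = Fin.toℕ-injective (trans (toℕ-mod i n) (trans eq (sym (toℕ-mod j n))))

Next-mod : ∀ n .{{_ : NonZero n}} i → Next n (i mod n) (suc i mod n)
Next-mod n i with suc-% i n
... | inj₁ eq = inj₁ (trans (toℕ-mod (suc i) n) (trans eq (cong suc (sym (toℕ-mod i n)))))
... | inj₂ (eq , eq′) = inj₂ (trans (cong suc (toℕ-mod i n)) eq , trans (toℕ-mod (suc i) n) eq′)

-- Cycles as periodic sequences

-- A parametrisation of a cycle: the choice of a base point and an orientation.
record Tour (G : Graph) (n : ℕ) : Set where
  open Graph G
  field
    at       : ℕ → Vertex
    periodic : ∀ i → at (n + i) ≡ at i
    step     : ∀ i → at i ~ at (suc i)
    distinct : ∀ i {k} → 0 < k → k < n → at i ≢ at (i + k)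

  Arc : Rel Vertex _
  Arc u v = ∃[ i ] at i ≡ u × at (suc i) ≡ v

  Edge : Rel Vertex _
  Edge = SymClosure Arc

open Tour using (Edge)

module _ {G : Graph} {n : ℕ} where
  open Graph G

  infix 4 _≋_
  infix 4 _⇄_
  -- Comparing edges identifies the cycles: each vertex of a tour is an end of one of its edges, so
  -- the vertex sets agree too (`≋⇒at`).
  record _≋_ (s t : Tour G n) : Set where
    constructor _⇄_
    field
      to   : Edge s ⇒ Edge t
      from : Edge t ⇒ Edge s

  ≋-sym : ∀ {s t} → s ≋ t → t ≋ s
  ≋-sym (p ⇄ q) = q ⇄ p

  ≋-trans : ∀ {s t u} → s ≋ t → t ≋ u → s ≋ u
  ≋-trans (p ⇄ q) (p′ ⇄ q′) = (p′ ∘ p) ⇄ (q ∘ q′)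

  agree⇒Edge⇒ : ∀ {s t : Tour G n} → (∀ i → Tour.at s i ≡ Tour.at t i) → Edge s ⇒ Edge t
  agree⇒Edge⇒ eq = gmap id λ { (i , refl , refl) → i , sym (eq i) , sym (eq (suc i)) }

  Edge⇒~ : ∀ (t : Tour G n) → Edge t ⇒ _~_
  Edge⇒~ t = fold ~-sym λ { (i , refl , refl) → Tour.step t i }

  at⇒Edge : ∀ (t : Tour G n) {v} → ∃[ i ] Tour.at t i ≡ v → ∃[ u ] Edge t v u
  at⇒Edge t (i , eq) = Tour.at t (suc i) , fwd (i , eq , refl)

  Edge⇒at : ∀ (t : Tour G n) {u v} → Edge t u v → ∃[ i ] Tour.at t i ≡ u
  Edge⇒at t (fwd (i , eq , _)) = i , eq
  Edge⇒at t (bwd (i , _ , eq)) = suc i , eq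

  ≋⇒at : ∀ {s t : Tour G n} → s ≋ t → ∀ i → ∃[ j ] Tour.at t j ≡ Tour.at s i
  ≋⇒at {s} {t} (p ⇄ _) i = Edge⇒at t (p (proj₂ (at⇒Edge s (i , refl))))

module _ {G : Graph} {ℓ : ℕ} where
  open Graph G

  private
    n : ℕ
    n = suc ℓ

  module _ (t : Tour G n) where
    open Tour t hiding (Edge)

    at-+* : ∀ i k → at (i + k * n) ≡ at i
    at-+* i zero = cong at (+-identityʳ i)
    at-+* i (suc k) = trans (cong at (lemma i k ℓ)) (trans (periodic (i + k * n)) (at-+* i k))
      where
      lemma : ∀ i k ℓ → i + suc k * suc ℓ ≡ suc ℓ + (i + k * suc ℓ)
      lemma = solve-∀

    at-% : ∀ i → at (i % n) ≡ at i
    at-% i = trans (sym (at-+* (i % n) (i / n))) (cong at (sym (m≡m%n+[m/n]*n i n)))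

    at-injective : ∀ {i j} → i < n → j < n → at i ≡ at j → i ≡ j
    at-injective {i} {j} i<n j<n eq with <-cmp i j
    ... | tri≈ _ i≡j _ = i≡j
    ... | tri< i<j _ _ = contradiction (trans eq (cong at (sym (m+[n∸m]≡n (<⇒≤ i<j)))))
                           (distinct i (m<n⇒0<n∸m i<j) (≤-<-trans (m∸n≤m j i) j<n))
    ... | tri> _ _ j<i = contradiction (trans (sym eq) (cong at (sym (m+[n∸m]≡n (<⇒≤ j<i)))))
                           (distinct j (m<n⇒0<n∸m j<i) (≤-<-trans (m∸n≤m i j) i<n))

    at-injective-% : ∀ {i j} → at i ≡ at j → i % n ≡ j % n
    at-injective-% {i} {j} eq =
      at-injective (m%n<n i n) (m%n<n j n) (trans (at-% i) (trans eq (sym (at-% j))))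

    rotate : ℕ → Tour G n
    rotate r = record
      { at       = λ i → at (r + i)
      ; periodic = λ i → trans (cong at (lemma r ℓ i)) (periodic (r + i))
      ; step     = λ i → subst (at (r + i) ~_) (cong at (sym (+-suc r i))) (step (r + i))
      ; distinct = λ i {k} 0<k k<n eq → distinct (r + i) 0<k k<n (trans eq (cong at (sym (+-assoc r i k))))
      }
      where
      lemma : ∀ r ℓ i → r + (suc ℓ + i) ≡ suc ℓ + (r + i)
      lemma = solve-∀

    -- Since ℓ = n ∸ 1, the index i * ℓ is congruent to - i modulo n.
    reverse : Tour G n
    reverse = record
      { at       = λ i → at (i * ℓ)
      ; periodic = λ i → trans (cong at (lemma₁ ℓ i)) (at-+* (i * ℓ) ℓ)
      -- The index `suc i * ℓ` is `ℓ + i * ℓ`; one more forward step completes a period and returns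
      -- to `i * ℓ`.
      ; step     = λ i → ~-sym (subst (at (ℓ + i * ℓ) ~_) (periodic (i * ℓ)) (step (ℓ + i * ℓ)))
      ; distinct = λ i {k} 0<k k<n eq → distinct ((i + k) * ℓ) 0<k k<n
          (sym (trans (cong at (lemma₂ ℓ i k)) (trans (at-+* (i * ℓ) k) eq)))
      }
      where
      lemma₁ : ∀ ℓ i → (suc ℓ + i) * ℓ ≡ i * ℓ + ℓ * suc ℓ
      lemma₁ = solve-∀
      lemma₂ : ∀ ℓ i k → (i + k) * ℓ + k ≡ i * ℓ + k * suc ℓ
      lemma₂ = solve-∀

  agree⇒≋ : ∀ {s t : Tour G n} → (∀ i → i < n → Tour.at s i ≡ Tour.at t i) → s ≋ t
  agree⇒≋ {s} {t} eq = agree⇒Edge⇒ {s = s} {t} everywhere ⇄ agree⇒Edge⇒ {s = t} {s} (sym ∘ everywhere)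
    where
    everywhere : ∀ i → Tour.at s i ≡ Tour.at t i
    everywhere i = trans (sym (at-% s i)) (trans (eq (i % n) (m%n<n i n)) (at-% t i))

  -- Rotations by `r` and then by `r * ℓ` add up to `r` full periods, so `onto`, applied to the
  -- rotated tour, also yields the converse inclusion.
  rotate-≋ : ∀ t r → rotate t r ≋ t
  rotate-≋ t r = onto t r ⇄ (onto (rotate t r) (r * ℓ) ∘ agree⇒Edge⇒ {s = t} {rotate (rotate t r) (r * ℓ)} back)
    where
    onto : ∀ t r → Edge (rotate t r) ⇒ Edge t
    onto t r = gmap id λ { (i , eq , eq′) → r + i , eq , trans (cong (Tour.at t) (sym (+-suc r i))) eq′ }
    lemma : ∀ r ℓ i → i + r * suc ℓ ≡ r + (r * ℓ + i)
    lemma = solve-∀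
    back : ∀ i → Tour.at t i ≡ Tour.at t (r + (r * ℓ + i))
    back i = trans (sym (at-+* t i r)) (cong (Tour.at t) (lemma r ℓ i))

  reverse-at-ℓ : ∀ t → Tour.at (reverse t) ℓ ≡ Tour.at t 1
  reverse-at-ℓ t = trans (sym (periodic (ℓ * ℓ))) (trans (cong at (lemma ℓ)) (at-+* t 1 ℓ))
    where
    open Tour t
    lemma : ∀ ℓ → suc ℓ + ℓ * ℓ ≡ 1 + ℓ * suc ℓ
    lemma = solve-∀

  reverse-at-1 : ∀ t → Tour.at (reverse t) 1 ≡ Tour.at t ℓ
  reverse-at-1 t = cong (Tour.at t) (+-identityʳ ℓ)

  -- Reversing twice multiplies indices by `ℓ * ℓ`, which is 1 modulo `n`; hence one inclusion again
  -- yields both.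
  reverse-≋ : ∀ t → reverse t ≋ t
  reverse-≋ t = onto t ⇄ (onto (reverse t) ∘ agree⇒Edge⇒ {s = t} {reverse (reverse t)} back)
    where
    onto : ∀ t → Edge (reverse t) ⇒ Edge t
    onto t (fwd (i , eq , eq′)) = bwd (ℓ + i * ℓ , eq′ , trans (Tour.periodic t (i * ℓ)) eq)
    onto t (bwd (i , eq , eq′)) = fwd (ℓ + i * ℓ , eq′ , trans (Tour.periodic t (i * ℓ)) eq)
    lemma : ∀ ℓ i → i * ℓ * ℓ + i * suc ℓ ≡ i + i * ℓ * suc ℓ
    lemma = solve-∀
    back : ∀ i → Tour.at t i ≡ Tour.at t (i * ℓ * ℓ)
    back i = sym (trans (sym (at-+* t (i * ℓ * ℓ) i)) (trans (cong (Tour.at t) (lemma ℓ i)) (at-+* t i (i * ℓ))))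

  -- A normal form: the base point is chosen freely, and the orientation is then fixed by the labels
  -- of its two neighbours on the cycle, which differ because `2 ≤ ℓ`.
  rebase : 2 ≤ ℓ → ∀ (t : Tour G n) i → ∃[ s ] s ≋ t × Tour.at s 0 ≡ Tour.at t i ×
                                   toℕ (Tour.at s 1) < toℕ (Tour.at s ℓ)
  rebase (s≤s (s≤s z≤n)) t i with <-cmp (toℕ (Tour.at (rotate t i) 1)) (toℕ (Tour.at (rotate t i) ℓ))
  ... | tri< lt _ _ = rotate t i , rotate-≋ t i , cong (Tour.at t) (+-identityʳ i) , lt
  ... | tri≈ _ eq _ = contradiction (Fin.toℕ-injective eq) (Tour.distinct (rotate t i) 1 (s≤s z≤n) (m<n⇒m<1+n ≤-refl))
  ... | tri> _ _ gt = reverse s , ≋-trans (reverse-≋ s) (rotate-≋ t i) , cong (Tour.at t) (+-identityʳ i) ,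
      subst₂ (λ u v → toℕ u < toℕ v) (sym (reverse-at-1 s)) (sym (reverse-at-ℓ s)) gt
    where s = rotate t i

  -- Tours versus cycles as subgraphs

  module _ (φ : Fin n → Vertex) (φ-injective : Injective _≡_ _≡_ φ) (φ-step : Next n =[ φ ]⇒ _~_) where

    -- Serves to parametrise a given cycle (`fromCycle`) and to build a tour from explicit labels
    -- (`trace`).
    unroll : Tour G n
    unroll = record
      { at       = λ i → φ (i mod n)
      ; periodic = λ i → cong φ (mod-cong (n + i) i (trans (cong (_% n) (+-comm n i)) ([m+n]%n≡m%n i n)))
      ; step     = λ i → φ-step (Next-mod n i)
      ; distinct = λ i {k} 0<k k<n eq → %≢+% n i 0<k k<n
          (trans (sym (toℕ-mod i n)) (trans (cong toℕ (φ-injective eq)) (toℕ-mod (i + k) n)))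
      }

  toCycle : Tour G n → Σ[ H ∈ Subgraph G ] IsCycle n H
  toCycle t = record
    { vertices = λ v → ∃[ i ] at i ≡ v
    ; edges    = Edge t
    ; edge-sym = symmetric Arc
    ; edge⇒~   = Edge⇒~ t
    ; endpoint = Edge⇒at t
    } , record
    { φ           = at ∘ toℕ
    ; φ-injective = λ eq → Fin.toℕ-injective (at-injective t (Fin.toℕ<n _) (Fin.toℕ<n _) eq)
    ; φ-image     = (λ { (i , eq) → i mod n , trans (cong at (toℕ-mod i n)) (trans (at-% t i) eq) })
                  , λ { (i , eq) → toℕ i , eq }
    ; φ-adjacency = gmap (at ∘ toℕ) Next⇒Arc
                  , λ { (fwd a) → fwd (Arc⇒Next a) ; (bwd a) → bwd (Arc⇒Next a) }
    }
    where
    open Tour t hiding (Edge)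
    Next⇒Arc : Next n =[ at ∘ toℕ ]⇒ Arc
    Next⇒Arc {i} (inj₁ eq) = toℕ i , refl , cong at (sym eq)
    Next⇒Arc {i} {j} (inj₂ (wraps , eq)) = toℕ i , refl ,
      trans (cong at (trans wraps (sym (+-identityʳ n)))) (trans (periodic 0) (cong at (sym eq)))

    residue : ∀ k (i : Fin n) → at k ≡ at (toℕ i) → k mod n ≡ i
    residue k i eq = trans (mod-cong k (toℕ i) (at-injective-% t eq)) (mod-toℕ i)

    Arc⇒Next : ∀ {i j} → Arc (at (toℕ i)) (at (toℕ j)) → Next n i j
    Arc⇒Next {i} {j} (k , eq , eq′) =
      subst₂ (Next n) (residue k i eq) (residue (suc k) j eq′) (Next-mod n k)

  module _ {H : Subgraph G} (C : IsCycle n H) where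
    open Subgraph H
    open IsCycle C

    fromCycle : Tour G n
    fromCycle = unroll φ φ-injective (edge⇒~ ∘ proj₁ φ-adjacency ∘ fwd)

    edges⇔fromCycle : edges ⇔ Edge fromCycle
    edges⇔fromCycle = into , fold edge-sym λ { (i , refl , refl) → proj₁ φ-adjacency (fwd (Next-mod n i)) }
      where
      Next⇒Arc : Next n =[ φ ]⇒ Tour.Arc fromCycle
      Next⇒Arc {i} {j} next = toℕ i , cong φ (mod-toℕ i) , cong φ (Fin.toℕ-injective (lemma next))
        where
        lemma : Next n i j → toℕ (suc (toℕ i) mod n) ≡ toℕ j
        lemma (inj₁ eq) = trans (cong (λ x → toℕ (x mod n)) (sym eq)) (cong toℕ (mod-toℕ j))
        lemma (inj₂ (wraps , eq)) = trans (cong (λ x → toℕ (x mod n)) wraps)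
          (trans (toℕ-mod n n) (trans (n%n≡0 n) (sym eq)))

      into : edges ⇒ Edge fromCycle
      -- `φ-adjacency` speaks of vertices in the image of `φ`; `endpoint` places both ends of the
      -- edge there.
      into e with proj₁ φ-image (endpoint e) | proj₁ φ-image (endpoint (edge-sym e))
      ... | _ , refl | _ , refl = gmap φ Next⇒Arc (proj₂ φ-adjacency e)

    vertices⇒fromCycle : ∀ {v} → vertices v → ∃[ i ] Tour.at fromCycle i ≡ v
    vertices⇒fromCycle v∈H with proj₁ φ-image v∈H
    ... | i , eq = toℕ i , trans (cong φ (mod-toℕ i)) eq

  -- Counting cycles becomes listing tours up to `≋`: equivalent tours trace equal cycles, and every
  -- cycle is traced by its `fromCycle`.
  hasExactlyCycles : ∀ {m} (w : Fin m → Tour G n) → (∀ i j → w i ≋ w j → i ≡ j) →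
                     (∀ t → ∃[ i ] w i ≋ t) → HasExactlyCycles G m n
  hasExactlyCycles w injective exhaustive = record
    { to        = toCycle ∘ w
    ; cong      = λ { refl → (id , id) , (id , id) }
    ; bijective = (λ { {i} {j} (_ , eq) → injective i j (proj₁ eq ⇄ proj₂ eq) }) , surjective
    }
    where
    open Setoid (cycles G n) using (_≈_)
    surjective : ∀ c → ∃[ i ] (∀ {j} → j ≡ i → toCycle (w j) ≈ c)
    surjective (H , C) with exhaustive (fromCycle C)
    ... | i , w≋c@(w⇒c ⇄ c⇒w) = i , λ { refl →
        ( (λ { (k , refl) → let j , eq = ≋⇒at w≋c k in
                            subst (Subgraph.vertices H) eq (proj₂ (IsCycle.φ-image C) (_ , refl)) })
        , (λ v∈H → let k , eq = vertices⇒fromCycle C v∈H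
                       j , eq′ = ≋⇒at (≋-sym w≋c) k
                   in j , trans eq′ eq) )
        , (proj₂ (edges⇔fromCycle C) ∘ w⇒c , c⇒w ∘ proj₁ (edges⇔fromCycle C)) }

-- Strategies

module _ (G : Graph) where
  open Graph G
  open Game G hiding (IsCopWin; IsKillerWin)

  -- The cop is to move.
  Forced : ℕ → (c k : Vertex) → Set
  Forced zero    c k = ⊥
  Forced (suc d) c k = ∀ c′ → c ~ c′ → c′ ≢ k × ∃[ k′ ] k ~ k′ × (k′ ≡ c′ ⊎ Forced d c′ k′)

  -- Used both as the search by which the killer finds his replies and to settle two small graphs by
  -- evaluation.
  forced?   : ∀ d c k → Dec (Forced d c k)
  response? : ∀ d c k → Dec (∃[ k′ ] k ~ k′ × (k′ ≡ c ⊎ Forced d c k′))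
  forced? zero    c k = no λ ()
  forced? (suc d) c k = Fin.all? λ c′ → (c ~? c′) →-dec (¬? (c′ Fin.≟ k) ×-dec response? d c′ k)
  response? d c k = Fin.any? λ k′ → (k ~? k′) ×-dec (k′ Fin.≟ c ⊎-dec forced? d c k′)

  move⇒~ : (∀ u → ∃[ v ] u ~ v) → ∀ {u v} → Move u v → u ~ v
  move⇒~ neighbour (inj₁ u~v) = u~v
  move⇒~ neighbour {u} (inj₂ (isolated , _)) = contradiction (proj₂ (neighbour u)) (isolated _)

  -- The history is the clock of the strategy: its length tells how many of the `D` allotted rounds
  -- are left, and the killer searches for a reply that wins within them. As no vertex is isolated,
  -- every move follows an edge.
  forced⇒killerWin : ∀ d → (∀ u → ∃[ v ] u ~ v) →
                     (∀ c → ∃[ k ] k ≢ c × Forced d c k) → IsKillerWin G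
  forced⇒killerWin D neighbour opening = τ , λ σ →
    win σ D 0 (+-identityʳ D) (proj₂ (proj₂ (opening _))) λ _ ()
    where
    respond : ℕ → (c k : Vertex) → ∃[ k′ ] k ~ k′
    respond d c k with response? d c k
    ... | yes (k′ , k~k′ , _) = k′ , k~k′
    -- A default for positions without a good reply, which do not occur before the killer's capture.
    ... | no _                = neighbour k

    τ : KillerStrategy
    τ = record
      { start = λ c → proj₁ (opening c) , proj₁ (proj₂ (opening c))
      ; move  = λ h c k → let k′ , k~k′ = respond (D ∸ length h) c k in k′ , inj₁ k~k′
      }

    module _ (σ : CopStrategy) where
      open Play σ τ

      length-history : ∀ t → length (proj₁ (state t)) ≡ t
      length-history zero    = refl
      length-history (suc t) = cong suc (length-history t)

      respond-correct : ∀ {d e} → e ≡ d → ∀ {c k} → ∃[ k′ ] k ~ k′ × (k′ ≡ c ⊎ Forced d c k′) →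
                        let k′ = proj₁ (respond e c k) in k′ ≡ c ⊎ Forced d c k′
      respond-correct {d} refl {c} {k} good with response? d c k
      ... | yes (_ , _ , p) = p
      ... | no bad          = contradiction good bad

      win : ∀ d t → d + t ≡ D → Forced d (cop t) (killer t) →
            (∀ s → s < t → ¬ CopCaptures s) → KillerWins
      win (suc d) t eq forced safe = continue (respond-correct remaining (proj₂ now))
        where
        now = forced (cop (suc t)) (move⇒~ neighbour (proj₂ (CopStrategy.move σ _ _ _)))

        -- The history seen by the killer already contains the current round, hence `suc t` rather
        -- than `t`.
        remaining : D ∸ length (proj₁ (state (suc t))) ≡ d
        remaining = trans (cong₂ _∸_ (trans (sym eq) (sym (+-suc d t))) (length-history (suc t)))
                          (m+n∸n≡m d (suc t))

        safe′ : ∀ s → s < suc t → ¬ CopCaptures s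
        safe′ s s<1+t with m≤n⇒m<n∨m≡n (s≤s⁻¹ s<1+t)
        ... | inj₁ s<t  = safe s s<t
        ... | inj₂ refl = proj₁ now

        continue : killer (suc t) ≡ cop (suc t) ⊎ Forced d (cop (suc t)) (killer (suc t)) → KillerWins
        continue (inj₁ captured) = t , captured , λ s → safe′ s ∘ s≤s
        continue (inj₂ forced′)  = win d (suc t) (trans (+-suc d t) eq) forced′ safe′

  -- The cop starts at `u` and captures with her first move; `neighbour` supplies a legal move
  -- wherever she is not next to the killer.
  universal⇒copWin : (∀ u → ∃[ v ] u ~ v) → ∀ u → (∀ v → v ≢ u → u ~ v) → IsCopWin G
  universal⇒copWin neighbour u universal = σ , λ τ → 0 , captures τ , λ _ ()
    where
    chase : (c k : Vertex) → ∃[ c′ ] c ~ c′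
    chase c k with c ~? k
    ... | yes c~k = k , c~k
    ... | no _    = neighbour c

    chase-adjacent : ∀ {c k} → c ~ k → proj₁ (chase c k) ≡ k
    chase-adjacent {c} {k} c~k with c ~? k
    ... | yes _   = refl
    ... | no ¬c~k = contradiction c~k ¬c~k

    σ : CopStrategy
    σ = record
      { start = u
      ; move  = λ _ c k → let c′ , c~c′ = chase c k in c′ , inj₁ c~c′
      }

    captures : ∀ τ → Play.CopCaptures σ τ 0
    captures τ = chase-adjacent (universal _ (proj₂ (KillerStrategy.start τ u)))

-- Graphs and closed walks on the labels `0, …, M`

record Arcs : Set₁ where
  field
    Arc   : Rel ℕ 0ℓ
    -- Each edge is listed from its smaller to its larger end, which makes the graph irreflexive for
    -- every `M`.
    arc⇒< : Arc ⇒ _<_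
    arc?  : Decidable Arc

  Adjacent : Rel ℕ 0ℓ
  Adjacent = SymClosure Arc

open Arcs using (Adjacent)

-- The vertices are 0, …, M.
fromArcs : Arcs → ℕ → Graph
fromArcs A M = record
  { order    = suc M
  ; _~_      = Adjacent A on toℕ
  ; ~-sym    = symmetric Arc
  ; ~-irrefl = λ { refl (fwd a) → <-irrefl refl (arc⇒< a) ; refl (bwd a) → <-irrefl refl (arc⇒< a) }
  ; _~?_     = λ u v → map′ (λ { (inj₁ a) → fwd a ; (inj₂ a) → bwd a })
                            (λ { (fwd a) → inj₁ a ; (bwd a) → inj₂ a })
                            (arc? (toℕ u) (toℕ v) ⊎-dec arc? (toℕ v) (toℕ u))
  }
  where open Arcs A using (Arc; arc⇒<; arc?)

module _ {G : Graph} {n : ℕ} where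

  -- The invariant that separates the listed cycles. It depends only on the vertex set, so
  -- equivalent tours share it; skipping 0 ignores the hub, which lies on almost all of them.
  LeastPositive : ℕ → Tour G n → Set
  LeastPositive j t = (∃[ i ] toℕ (Tour.at t i) ≡ j) ×
                      (∀ i → toℕ (Tour.at t i) ≢ 0 → j ≤ toℕ (Tour.at t i))

  leastPositive-mono : ∀ {i j s t} → LeastPositive i s → LeastPositive j t → 0 < j → s ≋ t → i ≤ j
  leastPositive-mono (_ , least) ((k , refl) , _) 0<j s≋t with ≋⇒at (≋-sym s≋t) k
  ... | k′ , eq = subst (_ ≤_) (cong toℕ eq) (least k′ λ eq′ → <⇒≢ 0<j (trans (sym eq′) (cong toℕ eq)))

  leastPositive-injective : ∀ {m} (label : Fin m → ℕ) → (∀ {i j} → label i ≡ label j → i ≡ j) →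
    (∀ i → 0 < label i) → (w : Fin m → Tour G n) → (∀ i → LeastPositive (label i) (w i)) →
    ∀ i j → w i ≋ w j → i ≡ j
  leastPositive-injective label label-injective positive w least i j eq = label-injective (≤-antisym
    (leastPositive-mono (least i) (least j) (positive j) eq)
    (leastPositive-mono (least j) (least i) (positive i) (≋-sym eq)))

-- One round of a cycle on indices `0, …, ℓ`, which `trace` repeats periodically. Total functions
-- such as `window` and `detour` can be plugged in directly.
record Circuit (A : Arcs) (M ℓ : ℕ) : Set where
  field
    vertex    : ℕ → ℕ
    bounded   : ∀ i → i ≤ ℓ → vertex i ≤ M
    injective : ∀ i j → i ≤ ℓ → j ≤ ℓ → vertex i ≡ vertex j → i ≡ j
    step      : ∀ i → i < ℓ → Adjacent A (vertex i) (vertex (suc i))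
    close     : Adjacent A (vertex ℓ) (vertex 0)

module _ (A : Arcs) (M : ℕ) {ℓ : ℕ} (C : Circuit A M ℓ) where
  open Circuit C

  private
    n = suc ℓ

    φ : Fin n → Fin (suc M)
    φ i = fromℕ< (s≤s (bounded (toℕ i) (Fin.toℕ≤pred[n] i)))

    toℕ-φ : ∀ i → toℕ (φ i) ≡ vertex (toℕ i)
    toℕ-φ i = Fin.toℕ-fromℕ< (s≤s (bounded (toℕ i) (Fin.toℕ≤pred[n] i)))

    φ-injective : ∀ {i j} → φ i ≡ φ j → i ≡ j
    φ-injective {i} {j} eq = Fin.toℕ-injective (injective _ _ (Fin.toℕ≤pred[n] i) (Fin.toℕ≤pred[n] j)
      (trans (sym (toℕ-φ i)) (trans (cong toℕ eq) (toℕ-φ j))))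

    vertex-step : ∀ i j → j ≤ ℓ → j ≡ suc i ⊎ (suc i ≡ n × j ≡ 0) → Adjacent A (vertex i) (vertex j)
    vertex-step i j j≤ℓ (inj₁ refl)          = step i j≤ℓ
    vertex-step i j _   (inj₂ (refl , refl)) = close

    φ-step : Next n =[ φ ]⇒ Graph._~_ (fromArcs A M)
    φ-step {i} {j} next = subst₂ (Adjacent A) (sym (toℕ-φ i)) (sym (toℕ-φ j))
      (vertex-step (toℕ i) (toℕ j) (Fin.toℕ≤pred[n] j) next)

  trace : Tour (fromArcs A M) n
  trace = unroll φ φ-injective φ-step

  toℕ-trace : ∀ i → toℕ (Tour.at trace i) ≡ vertex (i % n)
  toℕ-trace i = trans (toℕ-φ (i mod n)) (cong vertex (toℕ-mod i n))

  toℕ-trace-≤ : ∀ i → i ≤ ℓ → toℕ (Tour.at trace i) ≡ vertex i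
  toℕ-trace-≤ i i≤ℓ = trans (toℕ-trace i) (cong vertex (m<n⇒m%n≡m (s≤s i≤ℓ)))

  trace-≋ : ∀ t → (∀ i → i ≤ ℓ → toℕ (Tour.at t i) ≡ vertex i) → trace ≋ t
  trace-≋ t eq = agree⇒≋ λ i i<n →
    Fin.toℕ-injective (trans (toℕ-trace-≤ i (s≤s⁻¹ i<n)) (sym (eq i (s≤s⁻¹ i<n))))

  trace-leastPositive : ∀ {j} k → k ≤ ℓ → vertex k ≡ j → (∀ i → vertex i ≢ 0 → j ≤ vertex i) →
                        LeastPositive j trace
  trace-leastPositive k k≤ℓ eq least = (k , trans (toℕ-trace-≤ k k≤ℓ) eq) ,
    λ i nz → subst (_ ≤_) (sym (toℕ-trace i)) (least (i % n) (nz ∘ trans (toℕ-trace i)))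

-- Walks on a path without backtracking

Consecutive : Rel ℕ 0ℓ
Consecutive a b = b ≡ suc a ⊎ a ≡ suc b

module _ (r : ℕ → ℕ) (N : ℕ) (step : ∀ i → i < N → Consecutive (r i) (r (suc i)))
         (noReturn : ∀ i → suc i < N → r i ≢ r (suc (suc i))) where

  -- A change of direction would give `r i ≡ r (suc (suc i))`, against `noReturn`, so the first step
  -- decides. Its direction is assumed conditionally so that a walk of no steps is covered.
  ascending : (0 < N → r 1 ≡ suc (r 0)) → ∀ i → i < N → r (suc i) ≡ suc (r i)
  ascending up zero    0<N = up 0<N
  ascending up (suc i) i<N with step (suc i) i<N
  ... | inj₁ eq = eq
  ... | inj₂ eq = contradiction (suc-injective (trans (sym (ascending up i (<⇒≤ i<N))) eq)) (noReturn i i<N)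

  descending : (0 < N → r 0 ≡ suc (r 1)) → ∀ i → i < N → r i ≡ suc (r (suc i))
  descending down zero    0<N = down 0<N
  descending down (suc i) i<N with step (suc i) i<N
  ... | inj₂ eq = eq
  ... | inj₁ eq = contradiction (trans (descending down i (<⇒≤ i<N)) (sym eq)) (noReturn i i<N)

  ascending-+ : (0 < N → r 1 ≡ suc (r 0)) → ∀ i → i ≤ N → r i ≡ r 0 + i
  ascending-+ up zero    _   = sym (+-identityʳ (r 0))
  ascending-+ up (suc i) i<N =
    trans (ascending up i i<N) (trans (cong suc (ascending-+ up i (<⇒≤ i<N))) (sym (+-suc (r 0) i)))

  descending-+ : (0 < N → r 0 ≡ suc (r 1)) → ∀ i → i ≤ N → r i + i ≡ r 0
  descending-+ down zero    _   = +-identityʳ (r 0)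
  descending-+ down (suc i) i<N =
    trans (+-suc (r (suc i)) i) (trans (cong (_+ i) (sym (descending down i i<N))) (descending-+ down i (<⇒≤ i<N)))

  steady : 0 < N → (∀ i → i ≤ N → r i ≡ r 0 + i) ⊎ (∀ i → i ≤ N → r i + i ≡ r 0)
  steady 0<N with step 0 0<N
  ... | inj₁ up   = inj₁ (ascending-+ λ _ → up)
  ... | inj₂ down = inj₂ (descending-+ λ _ → down)

-- Fans

-- `S` selects the path vertices joined to the hub: all of them for the fan, those from 2 on for the
-- eared fan, the odd ones for the rows of squares.
FanArc : U.Pred ℕ 0ℓ → Rel ℕ 0ℓ
FanArc S i j = (i ≡ 0 × S j) ⊎ (0 < i × j ≡ suc i)

pattern spoke s = inj₁ (refl , s)
pattern rim p   = inj₂ (p , refl)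

module _ {S : U.Pred ℕ 0ℓ} where

  fanArc⇒< : S U.⊆ (0 <_) → FanArc S ⇒ _<_
  fanArc⇒< S⇒0< (spoke s) = S⇒0< s
  fanArc⇒< S⇒0< (rim _)   = ≤-refl

  fanArc? : U.Decidable S → Decidable (FanArc S)
  fanArc? S? i j = (i ≟ 0 ×-dec S? j) ⊎-dec (0 <? i ×-dec j ≟ suc i)

  fan-rim : ∀ {i j} → SymClosure (FanArc S) i j → i ≢ 0 → j ≢ 0 → Consecutive i j
  fan-rim (fwd (spoke _)) i≢0 j≢0 = contradiction refl i≢0
  fan-rim (fwd (rim _))   i≢0 j≢0 = inj₁ refl
  fan-rim (bwd (spoke _)) i≢0 j≢0 = contradiction refl j≢0
  fan-rim (bwd (rim _))   i≢0 j≢0 = inj₂ refl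

fanArcs : Arcs
fanArcs = record { Arc = FanArc (0 <_) ; arc⇒< = fanArc⇒< id ; arc? = fanArc? (0 <?_) }

fan : ℕ → Graph
fan = fromArcs fanArcs

window : ℕ → ℕ → ℕ
window j zero    = 0
window j (suc i) = j + i

window-injective : ∀ {j} → 0 < j → ∀ i i′ → window j i ≡ window j i′ → i ≡ i′
window-injective {j}     0<j zero    zero     eq = refl
window-injective {j}     0<j (suc i) (suc i′) eq = cong suc (+-cancelˡ-≡ j i i′ eq)
window-injective {suc _} 0<j zero    (suc i′) ()
window-injective {suc _} 0<j (suc i) zero     ()

window-least : ∀ j i → window j i ≢ 0 → j ≤ window j i
window-least j zero    nz = contradiction refl nz
window-least j (suc i) _  = m≤m+n j i

window-bounded : ∀ {j N M} → j + N ≤ M → ∀ i → i ≤ suc N → window j i ≤ M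
window-bounded b zero _ = z≤n
window-bounded {j} b (suc i) (s≤s i≤N) = ≤-trans (+-monoʳ-≤ j i≤N) b

window-step : ∀ {S : U.Pred ℕ 0ℓ} {j} → S j → 0 < j →
              ∀ i → SymClosure (FanArc S) (window j i) (window j (suc i))
window-step {S} {j} s 0<j zero    = fwd (spoke (subst S (sym (+-identityʳ j)) s))
window-step {j = j} s 0<j (suc i) = fwd (inj₂ (≤-trans 0<j (m≤m+n j i) , +-suc j i))

module _ {G : Graph} {N : ℕ} where

  private
    n = 3 + N

  -- A walk that avoids the hub is steady, so it never closes up.  Between two
  -- visits of the hub a tour runs through the path in one direction.
  classify : (t : Tour G n) →
             (∀ {u v} → Tour.Edge t u v → SymClosure (FanArc (0 <_)) (toℕ u) (toℕ v)) →
             ∃[ s ] s ≋ t × ∃[ j ] 0 < j × (∀ i → i ≤ 2 + N → toℕ (Tour.at s i) ≡ window j i)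
  classify t local with anyUpTo? (λ i → toℕ (Tour.at t i) ≟ 0) n
  ... | no noHub = contradiction (steady r n rims (λ i _ → noReturn i) (s≤s z≤n)) λ
        { (inj₁ up)   → m≢1+m+n (r 0) (trans r0≡rn (trans (up n ≤-refl) (+-suc (r 0) _)))
        ; (inj₂ down) → m≢1+m+n (r n) (trans (sym r0≡rn) (trans (sym (down n ≤-refl)) (+-suc (r n) _))) }
    where
    open Tour t
    r : ℕ → ℕ
    r i = toℕ (at i)
    r≢0 : ∀ i → r i ≢ 0
    r≢0 i eq = noHub (i % n , m%n<n i n , trans (cong toℕ (at-% t i)) eq)
    rims : ∀ i → i < n → Consecutive (r i) (r (suc i))
    rims i _ = fan-rim (local (fwd (i , refl , refl))) (r≢0 i) (r≢0 (suc i))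
    noReturn : ∀ i → r i ≢ r (suc (suc i))
    noReturn i eq = distinct i {2} (s≤s z≤n) (s≤s (s≤s (s≤s z≤n)))
      (trans (Fin.toℕ-injective eq) (cong at (+-comm 2 i)))
    r0≡rn : r 0 ≡ r n
    r0≡rn = cong toℕ (sym (trans (cong at (sym (+-identityʳ n))) (periodic 0)))
  ... | yes (i₀ , _ , hub) with rebase (s≤s (s≤s z≤n)) t i₀
  ... | s , s≋t@(s⇒t ⇄ _) , eq , lt = s , s≋t , r 0 , n≢0⇒n>0 (r≢0 0 z≤n) , λ
        { zero _ → s0 ; (suc i) i≤N → ascends (steady r (suc N) rims noReturn (s≤s z≤n)) i (s≤s⁻¹ i≤N) }
    where
    open Tour s
    s0 : toℕ (at 0) ≡ 0
    s0 = trans (cong toℕ eq) hub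
    r : ℕ → ℕ
    r i = toℕ (at (suc i))
    r≢0 : ∀ i → i ≤ suc N → r i ≢ 0
    r≢0 i i≤N eq = distinct 0 (s≤s z≤n) (s≤s (s≤s i≤N)) (Fin.toℕ-injective (trans s0 (sym eq)))
    rims : ∀ i → i < suc N → Consecutive (r i) (r (suc i))
    rims i i<N = fan-rim (local (s⇒t (fwd (suc i , refl , refl)))) (r≢0 i (<⇒≤ i<N)) (r≢0 (suc i) i<N)
    noReturn : ∀ i → suc i < suc N → r i ≢ r (suc (suc i))
    noReturn i _ eq = distinct (suc i) {2} (s≤s z≤n) (s≤s (s≤s (s≤s z≤n)))
      (trans (Fin.toℕ-injective eq) (cong at (+-comm 2 (suc i))))
    ascends : (∀ i → i ≤ suc N → r i ≡ r 0 + i) ⊎ (∀ i → i ≤ suc N → r i + i ≡ r 0) →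
              ∀ i → i ≤ suc N → r i ≡ r 0 + i
    ascends (inj₁ up)   = up
    -- The orientation chosen by `rebase` puts the smaller neighbour of the hub first, which
    -- excludes a descent.
    ascends (inj₂ down) = contradiction lt
      (≤⇒≯ (≤-trans (m≤m+n (r (suc N)) (suc N)) (≤-reflexive (down (suc N) ≤-refl))))

window-bound : ∀ {G N j} (t : Tour G (2 + N)) → toℕ (Tour.at t (suc N)) ≡ j + N → j + N < Graph.order G
window-bound t eq = subst (_< _) eq (Fin.toℕ<n (Tour.at t _))

leastPositive-distinct : ∀ {G n m} (w : Fin m → Tour G n) → (∀ i → LeastPositive (suc (toℕ i)) (w i)) →
           ∀ i j → w i ≋ w j → i ≡ j
leastPositive-distinct = leastPositive-injective (suc ∘ toℕ) (Fin.toℕ-injective ∘ suc-injective) (λ _ → s≤s z≤n)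

-- Windows of `2 + N` path vertices start at `1, …, m`, the last one ending at `m + suc N`; the
-- starting label is the least positive one.
fan-cycles : ∀ m N → HasExactlyCycles (fan (m + suc N)) m (3 + N)
fan-cycles m N = hasExactlyCycles w (leastPositive-distinct w least) exhaustive
  where
  bound : ∀ (i : Fin m) → suc (toℕ i) + suc N ≤ m + suc N
  bound i = +-monoˡ-≤ (suc N) (Fin.toℕ<n i)

  circuit : ∀ i → Circuit fanArcs (m + suc N) (2 + N)
  circuit i = record
    { vertex    = window (suc (toℕ i))
    ; bounded   = window-bounded (bound i)
    ; injective = λ k k′ _ _ → window-injective (s≤s z≤n) k k′
    ; step      = λ k _ → window-step (s≤s z≤n) (s≤s z≤n) k
    ; close     = bwd (spoke (s≤s z≤n))
    }

  w : Fin m → Tour (fan (m + suc N)) (3 + N)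
  w i = trace fanArcs _ (circuit i)

  least : ∀ i → LeastPositive (suc (toℕ i)) (w i)
  least i = trace-leastPositive fanArcs _ (circuit i) 1 (s≤s z≤n) (+-identityʳ _) (window-least _)

  exhaustive : ∀ t → ∃[ i ] w i ≋ t
  exhaustive t with classify t (Edge⇒~ t)
  ... | s , s≋t , suc j , _ , eq = fromℕ< j<m , ≋-trans (trace-≋ fanArcs _ (circuit _) s along) s≋t
    where
    j<m : j < m
    j<m = +-cancelʳ-≤ (suc N) (suc j) m (s≤s⁻¹ (window-bound {j = suc j} s (eq (2 + N) ≤-refl)))
    along : ∀ i → i ≤ 2 + N → toℕ (Tour.at s i) ≡ window (suc (toℕ (fromℕ< j<m))) i
    along i i≤ℓ = trans (eq i i≤ℓ) (cong (λ x → window (suc x) i) (sym (Fin.toℕ-fromℕ< j<m)))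

-- Fans with an ear

earedArcs : Arcs
earedArcs = record
  { Arc   = λ i j → FanArc (2 ≤_) i j ⊎ (i ≡ 1 × j ≡ 3)
  ; arc⇒< = λ { (inj₁ a) → fanArc⇒< (≤-trans (s≤s z≤n)) a ; (inj₂ (refl , refl)) → s≤s (s≤s z≤n) }
  ; arc?  = λ i j → fanArc? (2 ≤?_) i j ⊎-dec (i ≟ 1 ×-dec j ≟ 3)
  }

pattern chord = inj₂ (refl , refl)

eared : ℕ → Graph
eared = fromArcs earedArcs

avoid-ear : ∀ {i j} → Adjacent earedArcs i j → i ≢ 1 → j ≢ 1 → Adjacent fanArcs i j
avoid-ear a i≢1 j≢1 = go a
  where
  arc : ∀ {i j} → FanArc (2 ≤_) i j → FanArc (0 <_) i j
  arc (spoke s) = spoke (≤-trans (s≤s z≤n) s)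
  arc (rim p)   = rim p
  go : Adjacent earedArcs _ _ → Adjacent fanArcs _ _
  go (fwd (inj₁ a)) = fwd (arc a)
  go (bwd (inj₁ a)) = bwd (arc a)
  go (fwd chord)    = contradiction refl i≢1
  go (bwd chord)    = contradiction refl j≢1

neighbours-1 : ∀ {j} → Adjacent earedArcs 1 j → j ≡ 2 ⊎ j ≡ 3
neighbours-1 (fwd (inj₁ (inj₁ (() , _))))
neighbours-1 (fwd (inj₁ (rim _))) = inj₁ refl
neighbours-1 (fwd chord) = inj₂ refl
neighbours-1 (bwd (inj₁ (inj₁ (refl , s≤s ()))))
neighbours-1 (bwd (inj₁ (inj₂ (() , refl))))
neighbours-1 (bwd (inj₂ (_ , ())))

neighbours-2 : ∀ {j} → Adjacent earedArcs 2 j → j ≢ 1 → j ≢ 3 → j ≡ 0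
neighbours-2 (fwd (inj₁ (inj₁ (() , _))))
neighbours-2 (fwd (inj₁ (rim _)))   _ j≢3 = contradiction refl j≢3
neighbours-2 (fwd (inj₂ (() , _)))
neighbours-2 (bwd (inj₁ (spoke _))) _ _ = refl
neighbours-2 (bwd (inj₁ (rim _)))   j≢1 _ = contradiction refl j≢1
neighbours-2 (bwd (inj₂ (_ , ())))

-- The only cycle through the ear.
detour : ℕ → ℕ
detour 0 = 0
detour 1 = 2
detour 2 = 1
detour i = i

-- Gives injectivity of `detour`.
detour-involutive : ∀ i → detour (detour i) ≡ i
detour-involutive 0 = refl
detour-involutive 1 = refl
detour-involutive 2 = refl
detour-involutive (suc (suc (suc i))) = refl

detour-bounded : ∀ {M} → 2 ≤ M → ∀ i → i ≤ M → detour i ≤ M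
detour-bounded 2≤M 0 _ = z≤n
detour-bounded 2≤M 1 _ = 2≤M
detour-bounded 2≤M 2 _ = ≤-trans (s≤s z≤n) 2≤M
detour-bounded 2≤M (suc (suc (suc i))) i≤M = i≤M

detour-step : ∀ i → Adjacent earedArcs (detour i) (detour (suc i))
detour-step 0 = fwd (inj₁ (spoke ≤-refl))
detour-step 1 = bwd (inj₁ (rim (s≤s z≤n)))
detour-step 2 = fwd chord
detour-step (suc (suc (suc i))) = fwd (inj₁ (rim (s≤s z≤n)))

-- The tour starts with 1, 3 and ends with 2.  It enters 2 from the hub, since the
-- other neighbours of 2 are 1 and 3, and up to the hub it climbs the path.
around-ear : ∀ {M N} (s : Tour (eared M) (4 + N)) → toℕ (Tour.at s 0) ≡ 1 →
             toℕ (Tour.at s (3 + N)) < toℕ (Tour.at s 1) →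
             ∀ i → i ≤ 3 + N → toℕ (Tour.at s (2 + N + i)) ≡ detour i
around-ear {N = N} s q0 qℓ<q1 = around
  where
  open Tour s
  q : ℕ → ℕ
  q i = toℕ (at i)
  q-step : ∀ i → Adjacent earedArcs (q i) (q (suc i))
  q-step = step
  q-distinct : ∀ i {k} → 0 < k → k < 4 + N → q i ≢ q (i + k)
  q-distinct i 0<k k<n = distinct i 0<k k<n ∘ Fin.toℕ-injective
  qn : ∀ i → q (4 + N + i) ≡ q i
  qn i = cong toℕ (periodic i)
  ends : ∀ {a b} → a ≡ 2 ⊎ a ≡ 3 → b ≡ 2 ⊎ b ≡ 3 → a < b → a ≡ 2 × b ≡ 3
  ends (inj₁ refl) (inj₁ refl) lt = contradiction lt (<-irrefl refl)
  ends (inj₁ refl) (inj₂ refl) lt = refl , refl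
  ends (inj₂ refl) (inj₁ refl) lt = contradiction lt (<-asym (n<1+n 2))
  ends (inj₂ refl) (inj₂ refl) lt = contradiction lt (<-irrefl refl)
  q-ends : q (3 + N) ≡ 2 × q 1 ≡ 3
  q-ends = ends
    (neighbours-1 (subst (λ x → Adjacent earedArcs x (q (3 + N)))
      (trans (cong q (sym (+-identityʳ (4 + N)))) (trans (qn 0) q0))
      (symmetric _ (q-step (3 + N)))))
    (neighbours-1 (subst (λ x → Adjacent earedArcs x (q 1)) q0 (q-step 0)))
    qℓ<q1
  q-hub : q (2 + N) ≡ 0
  q-hub = neighbours-2
    (subst (λ x → Adjacent earedArcs x (q (2 + N))) (proj₁ q-ends) (symmetric _ (q-step (2 + N))))
    -- The labels 1 and 3 are already taken, at positions 0 and 1.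
    (λ e → q-distinct 0 {2 + N} (s≤s z≤n) (m<n⇒m<1+n ≤-refl) (trans q0 (sym e)))
    (λ e → q-distinct 1 {1 + N} (s≤s z≤n) (m<n⇒m<1+n (m<n⇒m<1+n ≤-refl)) (trans (proj₂ q-ends) (sym e)))
  r : ℕ → ℕ
  r i = q (suc i)
  r≢0 : ∀ i → i ≤ N → r i ≢ 0
  r≢0 i i≤N e = q-distinct (suc i) (s≤s z≤n) (s≤s (s≤s (≤-trans (m∸n≤m N i) (m≤n+m N 2))))
    (trans e (trans (sym q-hub) (cong q (sym (trans (+-suc (suc i) (N ∸ i)) (cong (2 +_) (m+[n∸m]≡n i≤N)))))))
  r≢1 : ∀ i → i ≤ N → r i ≢ 1
  r≢1 i i≤N e = q-distinct 0 (s≤s z≤n) (s≤s (≤-trans (s≤s i≤N) (m≤n+m (1 + N) 2))) (trans q0 (sym e))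
  rims : ∀ i → i < N → Consecutive (r i) (r (suc i))
  rims i i<N = fan-rim (avoid-ear (q-step (suc i)) (r≢1 i (<⇒≤ i<N)) (r≢1 (suc i) i<N))
    (r≢0 i (<⇒≤ i<N)) (r≢0 (suc i) i<N)
  noReturn : ∀ i → suc i < N → r i ≢ r (suc (suc i))
  noReturn i _ e = q-distinct (suc i) {2} (s≤s z≤n) (s≤s (s≤s (s≤s z≤n))) (trans e (cong q (+-comm 2 (suc i))))
  up : 0 < N → r 1 ≡ suc (r 0)
  up 0<N with rims 0 0<N
  ... | inj₁ e = e
  -- Descending from 3 would reach 2, the last vertex of the tour, too early.
  ... | inj₂ e = contradiction (trans (suc-injective (trans (sym e) (proj₂ q-ends))) (sym (proj₁ q-ends)))
                   (q-distinct 2 {1 + N} (s≤s z≤n) (s≤s (s≤s (m≤n+m N 2))))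
  shift : ∀ i N → 2 + N + (2 + i) ≡ 4 + N + i
  shift = solve-∀
  -- Read from the hub at index `2 + N`, the tour visits 2, then the ear at the start of the next
  -- period, then 3 and the climb.
  around : ∀ i → i ≤ 3 + N → q (2 + N + i) ≡ detour i
  around 0 _ = trans (cong q (+-identityʳ (2 + N))) q-hub
  around 1 _ = trans (cong q (+-comm (2 + N) 1)) (proj₁ q-ends)
  around 2 _ = trans (cong q (shift 0 N)) (trans (qn 0) q0)
  around (suc (suc (suc i))) i≤ℓ = trans (cong q (shift (suc i) N)) (trans (qn (suc i))
    (trans (ascending-+ r N rims noReturn up i (s≤s⁻¹ (s≤s⁻¹ (s≤s⁻¹ i≤ℓ)))) (cong (_+ i) (proj₂ q-ends))))

-- The detour has least positive label 1, and the `m` windows start at `2, …, m + 1`, the last one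
-- ending at `M`.
eared-cycles : ∀ m N → HasExactlyCycles (eared (suc m + (2 + N))) (suc m) (4 + N)
eared-cycles m N = hasExactlyCycles w (leastPositive-distinct w least) exhaustive
  where
  M = suc m + (2 + N)

  detourCircuit : Circuit earedArcs M (3 + N)
  detourCircuit = record
    { vertex    = detour
    ; bounded   = λ i i≤ℓ → detour-bounded (≤-trans (s≤s (s≤s z≤n)) (m≤n+m (2 + N) (suc m))) i
                              (≤-trans i≤ℓ (s≤s (m≤n+m (2 + N) m)))
    ; injective = λ i j _ _ eq → trans (sym (detour-involutive i)) (trans (cong detour eq) (detour-involutive j))
    ; step      = λ i _ → detour-step i
    ; close     = bwd (inj₁ (spoke (s≤s (s≤s z≤n))))
    }

  circuit : ∀ i → Circuit earedArcs M (3 + N)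
  circuit zero    = detourCircuit
  circuit (suc i) = record
    { vertex    = window (2 + toℕ i)
    ; bounded   = window-bounded (+-monoˡ-≤ (2 + N) (s≤s (Fin.toℕ<n i)))
    ; injective = λ k k′ _ _ → window-injective (s≤s z≤n) k k′
    ; step      = λ k _ → gmap id inj₁ (window-step (s≤s (s≤s z≤n)) (s≤s z≤n) k)
    ; close     = bwd (inj₁ (spoke (s≤s (s≤s z≤n))))
    }

  w : Fin (suc m) → Tour (eared M) (4 + N)
  w i = trace earedArcs M (circuit i)

  least : ∀ i → LeastPositive (suc (toℕ i)) (w i)
  least zero    = trace-leastPositive earedArcs M (circuit zero) 2 (s≤s (s≤s z≤n)) refl (λ _ → n≢0⇒n>0)
  least (suc i) = trace-leastPositive earedArcs M (circuit (suc i)) 1 (s≤s z≤n) (+-identityʳ _) (window-least _)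

  exhaustive : ∀ t → ∃[ i ] w i ≋ t
  exhaustive t with anyUpTo? (λ i → toℕ (Tour.at t i) ≟ 1) (4 + N)
  ... | no noEar = without (classify t local)
    where
    open Tour t hiding (Edge)
    at≢1 : ∀ i → toℕ (at i) ≢ 1
    at≢1 i eq = noEar (i % (4 + N) , m%n<n i (4 + N) , trans (cong toℕ (at-% t i)) eq)
    -- `classify` asks for fan adjacency only along the edges of the tour, so it applies to tours of
    -- the eared fan that miss the ear.
    local : ∀ {u v} → Edge t u v → Adjacent fanArcs (toℕ u) (toℕ v)
    local e = avoid-ear (Edge⇒~ t e) (λ eq → avoids (fwd′ e) eq) (λ eq → avoids (bwd′ e) eq)
      where
      avoids : ∀ {u} → ∃[ i ] at i ≡ u → toℕ u ≢ 1
      avoids (i , refl) = at≢1 i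
      fwd′ = Edge⇒at t
      bwd′ = Edge⇒at t ∘ symmetric Arc
    without : ∃[ s ] s ≋ t × ∃[ j ] 0 < j × (∀ i → i ≤ 3 + N → toℕ (Tour.at s i) ≡ window j i) →
              ∃[ i ] w i ≋ t
    -- A window starting at 1 would contain the ear.
    without (s , s≋t , 1 , _ , eq) with ≋⇒at s≋t 1
    ... | k , eq′ = contradiction (trans (cong toℕ eq′) (eq 1 (s≤s z≤n))) (at≢1 k)
    without (s , s≋t , suc (suc j) , _ , eq) =
      suc (fromℕ< j<m) , ≋-trans (trace-≋ earedArcs M (circuit (suc (fromℕ< j<m))) s along) s≋t
      where
      j<m : j < m
      j<m = s≤s⁻¹ (+-cancelʳ-≤ (2 + N) (2 + j) (suc m)
        (s≤s⁻¹ (window-bound {j = 2 + j} s (eq (3 + N) ≤-refl))))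
      along : ∀ i → i ≤ 3 + N → toℕ (Tour.at s i) ≡ window (2 + toℕ (fromℕ< j<m)) i
      along i i≤ℓ = trans (eq i i≤ℓ) (cong (λ x → window (2 + x) i) (sym (Fin.toℕ-fromℕ< j<m)))
  ... | yes (i₀ , _ , ear) with rebase (s≤s (s≤s z≤n)) t i₀
  -- Based at the ear, `s` begins towards 2 and returns from 3. Reversing it gives the orientation
  -- of `around-ear`, and rotating by `2 + N` then starts it at the hub.
  ... | s , s≋t , eq , lt = zero , ≋-trans (trace-≋ earedArcs M detourCircuit (rotate (reverse s) (2 + N)) along)
                                   (≋-trans (rotate-≋ (reverse s) (2 + N)) (≋-trans (reverse-≋ s) s≋t))
    where
    along : ∀ i → i ≤ 3 + N → toℕ (Tour.at (rotate (reverse s) (2 + N)) i) ≡ detour i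
    along = around-ear (reverse s) (trans (cong toℕ eq) ear)
      (subst₂ (λ u v → toℕ u < toℕ v) (sym (reverse-at-ℓ s)) (sym (reverse-at-1 s)) lt)

-- The game on the eared fan

module _ (A : Arcs) (M : ℕ) where

  -- `Forced` transcribed to natural labels, so that positions can be matched as numerals while `M`
  -- stays a variable.
  ForcedIn : ℕ → (c k : ℕ) → Set
  ForcedIn zero    c k = ⊥
  ForcedIn (suc d) c k = ∀ c′ → c′ ≤ M → Adjacent A c c′ → c′ ≢ k ×
    ∃[ k′ ] k′ ≤ M × Adjacent A k k′ × (k′ ≡ c′ ⊎ ForcedIn d c′ k′)

  vertex : ∀ {i} → i ≤ M → Fin (suc M)
  vertex i≤M = fromℕ< (s≤s i≤M)

  toℕ-vertex : ∀ {i} (i≤M : i ≤ M) → toℕ (vertex i≤M) ≡ i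
  toℕ-vertex i≤M = Fin.toℕ-fromℕ< (s≤s i≤M)

  lift-neighbour : (∀ i → i ≤ M → ∃[ j ] j ≤ M × Adjacent A i j) →
                   ∀ u → ∃[ v ] Graph._~_ (fromArcs A M) u v
  lift-neighbour neighbour u with neighbour (toℕ u) (Fin.toℕ≤pred[n] u)
  ... | j , j≤M , a = vertex j≤M , subst (Adjacent A (toℕ u)) (sym (toℕ-vertex j≤M)) a

  lift-forced : ∀ d c k → ForcedIn d (toℕ c) (toℕ k) → Forced (fromArcs A M) d c k
  lift-forced (suc d) c k forced c′ c~c′ with forced (toℕ c′) (Fin.toℕ≤pred[n] c′) c~c′
  ... | c′≢k , k′ , k′≤M , a , outcome =
      (λ { refl → c′≢k refl }) , vertex k′≤M ,
      subst (Adjacent A (toℕ k)) (sym (toℕ-vertex k′≤M)) a , lifted outcome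
    where
    lifted : k′ ≡ toℕ c′ ⊎ ForcedIn d (toℕ c′) k′ →
             vertex k′≤M ≡ c′ ⊎ Forced (fromArcs A M) d c′ (vertex k′≤M)
    lifted (inj₁ refl)    = inj₁ (Fin.toℕ-injective (toℕ-vertex k′≤M))
    lifted (inj₂ forced′) = inj₂ (lift-forced d c′ (vertex k′≤M)
      (subst (ForcedIn d (toℕ c′)) (sym (toℕ-vertex k′≤M)) forced′))

  forcedIn⇒killerWin : ∀ d → (∀ i → i ≤ M → ∃[ j ] j ≤ M × Adjacent A i j) →
                       (∀ c → c ≤ M → ∃[ k ] k ≤ M × k ≢ c × ForcedIn d c k) → IsKillerWin (fromArcs A M)
  forcedIn⇒killerWin d neighbour opening = forced⇒killerWin (fromArcs A M) d (lift-neighbour neighbour) λ c →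
    let k , k≤M , k≢c , forced = opening (toℕ c) (Fin.toℕ≤pred[n] c) in
    vertex k≤M , (λ eq → k≢c (trans (sym (toℕ-vertex k≤M)) (cong toℕ eq))) ,
    lift-forced d c (vertex k≤M) (subst (ForcedIn d (toℕ c)) (sym (toℕ-vertex k≤M)) forced)

-- The cop's position after a step towards the killer, measured from his new place `suc k` on the
-- left and from `k` on the right.
closer : ∀ k e → 3 + k + (e + e) ≡ 1 + (k + ((1 + e) + (1 + e)))
closer = solve-∀

module _ {M : ℕ} (5≤M : 5 ≤ M) where

  private
    _⇝_ : ℕ → ℕ → Set
    i ⇝ j = Adjacent earedArcs i j

    Caught : ℕ → ℕ → ℕ → Set
    Caught = ForcedIn earedArcs M

    hub-adjacent : ∀ {j} → 2 ≤ j → 0 ⇝ j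
    hub-adjacent = fwd ∘ inj₁ ∘ spoke

    adjacent-hub : ∀ {j} → 2 ≤ j → j ⇝ 0
    adjacent-hub = bwd ∘ inj₁ ∘ spoke

    forward : ∀ {i} → suc i ⇝ suc (suc i)
    forward = fwd (inj₁ (rim (s≤s z≤n)))

    backward : ∀ {i} → suc (suc i) ⇝ suc i
    backward = bwd (inj₁ (rim (s≤s z≤n)))

    _≤M : ∀ i {_ : True (i ≤? 5)} → i ≤ M
    _≤M i {p} = ≤-trans (toWitness p) 5≤M

  -- Each round the killer moves from k to k + 1, which keeps the distance even.
  -- The cop cannot pass: the hub is next to the killer, and so is the vertex
  -- between them when the distance is 2.
  chase : ∀ d k e → 2 ≤ k → suc (suc (k + (e + e))) ≤ M → M < k + d →
          Caught d (suc (suc (k + (e + e)))) k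
  -- `M < k + d` makes the rounds suffice: `k` grows by one per round but stays below the cop, hence
  -- below `M`.
  chase zero k e _ c≤M M<k = contradiction M<k
    (≤⇒≯ (≤-trans (≤-reflexive (+-identityʳ k)) (≤-trans (m≤m+n k (e + e)) (≤-trans (m≤n+m _ 2) c≤M))))
  chase (suc d) 1 e (s≤s ())
  chase (suc d) k@(suc (suc _)) e 2≤k c≤M M<k+d c′ c′≤M (bwd (inj₂ (_ , ())))
  chase (suc d) k@(suc (suc _)) e 2≤k c≤M M<k+d c′ c′≤M (bwd (inj₁ (spoke _))) =
    (λ ()) , 0 , z≤n , adjacent-hub 2≤k , inj₁ refl
  chase (suc d) k@(suc (suc _)) e 2≤k c≤M M<k+d c′ c′≤M (fwd (inj₁ (rim _))) =
    <⇒≢ k<c′ ∘ sym , suc k , ≤-trans k<c′ c′≤M , forward ,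
    inj₂ (chase d (suc k) e (m≤n⇒m≤1+n 2≤k) c′≤M (subst (M <_) (+-suc k d) M<k+d))
    where
    k<c′ : k < suc (suc (suc (k + (e + e))))
    k<c′ = s≤s (≤-trans (m≤m+n k (e + e)) (m≤n+m (k + (e + e)) 2))
  chase (suc d) k@(suc (suc _)) zero 2≤k c≤M M<k+d c′ c′≤M (bwd (inj₁ (rim _))) =
    (λ eq → m≢1+m+n k (sym eq)) , suc k , subst (_≤ M) (cong suc (+-identityʳ k)) c′≤M , forward ,
    inj₁ (cong suc (sym (+-identityʳ k)))
  chase (suc d) k@(suc (suc _)) (suc e) 2≤k c≤M M<k+d c′ c′≤M (bwd (inj₁ (rim _))) =
    (λ eq → m≢1+m+n k (sym eq)) , suc k , ≤-trans (s≤s (m≤m+n k _)) c′≤M , forward ,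
    inj₂ (subst (λ x → Caught d x (suc k)) (closer k e)
      (chase d (suc k) e (m≤n⇒m≤1+n 2≤k) (subst (_≤ M) (sym (closer k e)) c′≤M) (subst (M <_) (+-suc k d) M<k+d)))

  halve : ∀ i → ∃[ e ] (i ≡ e + e ⊎ i ≡ suc (e + e))
  halve zero = 0 , inj₁ refl
  halve (suc i) with halve i
  ... | e , inj₁ eq = e , inj₂ (cong suc eq)
  ... | e , inj₂ eq = suc e , inj₁ (cong suc (trans eq (sym (+-suc e e))))

  -- The killer takes whichever of 2 and 3 has the cop's parity. The distance is then even and
  -- positive, as `chase` requires.
  pursue : ∀ i → 4 + i ≤ M → ∃[ k ] (k ≡ 2 ⊎ k ≡ 3) × (∀ d → M ≤ d → Caught d (4 + i) k)
  pursue i c≤M with halve i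
  ... | e , inj₁ refl = 2 , inj₁ refl , λ d M≤d →
    chase d 2 e ≤-refl c≤M (m<n⇒m<1+n (s≤s M≤d))
  ... | e , inj₂ refl = 3 , inj₂ refl , λ d M≤d →
    chase d 3 e (s≤s (s≤s z≤n)) c≤M (m<n⇒m<1+n (m<n⇒m<1+n (s≤s M≤d)))

  -- Both exits of the ear are joined to the hub.
  caught-1-0 : ∀ d → Caught (suc d) 1 0
  caught-1-0 d c′ _ a with neighbours-1 a
  ... | inj₁ refl = (λ ()) , 2 , 2 ≤M , hub-adjacent ≤-refl , inj₁ refl
  ... | inj₂ refl = (λ ()) , 3 , 3 ≤M , hub-adjacent (s≤s (s≤s z≤n)) , inj₁ refl

  -- Near the start of the path the killer stands ahead of the cop. Her one move that is not
  -- punished at once leads into the ear, where he traps her from the hub.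
  caught-2-4 : ∀ d → Caught (2 + d) 2 4
  caught-2-4 d _ _ (bwd (inj₁ (spoke _))) = (λ ()) , 0 , z≤n , adjacent-hub (s≤s (s≤s z≤n)) , inj₁ refl
  caught-2-4 d _ _ (bwd (inj₁ (rim _)))   = (λ ()) , 0 , z≤n , adjacent-hub (s≤s (s≤s z≤n)) , inj₂ (caught-1-0 d)
  caught-2-4 d _ _ (fwd (inj₁ (rim _)))   = (λ ()) , 3 , 3 ≤M , backward , inj₁ refl

  caught-3-5 : ∀ d → Caught (3 + d) 3 5
  caught-3-5 d _ _ (bwd (inj₁ (spoke _))) = (λ ()) , 0 , z≤n , adjacent-hub (s≤s (s≤s z≤n)) , inj₁ refl
  caught-3-5 d _ _ (bwd chord)            = (λ ()) , 0 , z≤n , adjacent-hub (s≤s (s≤s z≤n)) , inj₂ (caught-1-0 (suc d))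
  caught-3-5 d _ _ (bwd (inj₁ (rim _)))   = (λ ()) , 4 , 4 ≤M , backward , inj₂ (caught-2-4 d)
  caught-3-5 d _ _ (fwd (inj₁ (rim _)))   = (λ ()) , 4 , 4 ≤M , backward , inj₁ refl

  -- In the ear the killer is next to both 2 and 3, so he learns the cop's parity before he enters
  -- the path.
  caught-0-1 : ∀ d → M ≤ d → Caught (suc d) 0 1
  caught-0-1 d M≤d 2 _ _ = (λ ()) , 2 , 2 ≤M , forward , inj₁ refl
  caught-0-1 d M≤d 3 _ _ = (λ ()) , 3 , 3 ≤M , fwd chord , inj₁ refl
  caught-0-1 d M≤d (suc (suc (suc (suc i)))) c′≤M _ with pursue i c′≤M
  ... | k , inj₁ refl , caught = (λ ()) , 2 , 2 ≤M , forward , inj₂ (caught d M≤d)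
  ... | k , inj₂ refl , caught = (λ ()) , 3 , 3 ≤M , fwd chord , inj₂ (caught d M≤d)
  caught-0-1 d M≤d 0 _ (fwd (inj₁ (inj₁ (_ , ()))))
  caught-0-1 d M≤d 0 _ (fwd (inj₁ (inj₂ (() , _))))
  caught-0-1 d M≤d 0 _ (fwd (inj₂ (() , _)))
  caught-0-1 d M≤d 0 _ (bwd (inj₁ (inj₁ (_ , ()))))
  caught-0-1 d M≤d 0 _ (bwd (inj₁ (inj₂ (() , _))))
  caught-0-1 d M≤d 0 _ (bwd (inj₂ (() , _)))
  caught-0-1 d M≤d 1 _ (fwd (inj₁ (inj₁ (_ , s≤s ()))))
  caught-0-1 d M≤d 1 _ (fwd (inj₁ (inj₂ (() , _))))
  caught-0-1 d M≤d 1 _ (fwd (inj₂ (() , _)))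
  caught-0-1 d M≤d 1 _ (bwd (inj₁ (inj₁ (() , _))))
  caught-0-1 d M≤d 1 _ (bwd (inj₁ (inj₂ (_ , ()))))
  caught-0-1 d M≤d 1 _ (bwd (inj₂ (_ , ())))

  eared-killerWin : IsKillerWin (eared M)
  -- A budget common to all openings: `M` rounds suffice for a pursuit, `caught-0-1` adds one, and
  -- `caught-3-5` takes three of its own.
  eared-killerWin = forcedIn⇒killerWin earedArcs M (3 + M) neighbour opening
    where
    neighbour : ∀ i → i ≤ M → ∃[ j ] j ≤ M × i ⇝ j
    neighbour 0             _ = 2 , 2 ≤M , hub-adjacent ≤-refl
    neighbour 1             _ = 2 , 2 ≤M , forward
    neighbour (suc (suc _)) _ = 0 , z≤n , adjacent-hub (s≤s (s≤s z≤n))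

    opening : ∀ c → c ≤ M → ∃[ k ] k ≤ M × k ≢ c × Caught (3 + M) c k
    opening 0 _ = 1 , 1 ≤M , (λ ()) , caught-0-1 (2 + M) (m≤n+m M 2)
    opening 1 _ = 0 , z≤n , (λ ()) , caught-1-0 (2 + M)
    opening 2 _ = 4 , 4 ≤M , (λ ()) , caught-2-4 (1 + M)
    opening 3 _ = 5 , 5 ≤M , (λ ()) , caught-3-5 M
    opening (suc (suc (suc (suc i)))) c≤M with pursue i c≤M
    ... | k , inj₁ refl , caught = 2 , 2 ≤M , (λ ()) , caught (3 + M) (m≤n+m M 3)
    ... | k , inj₂ refl , caught = 3 , 3 ≤M , (λ ()) , caught (3 + M) (m≤n+m M 3)

-- Squares

Odd : U.Pred ℕ 0ℓ
Odd j = j % 2 ≡ 1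

odd⇒positive : ∀ {j} → Odd j → 0 < j
odd⇒positive {suc _} _ = s≤s z≤n

squaresArcs : Arcs
squaresArcs = record
  { Arc   = FanArc Odd
  ; arc⇒< = fanArc⇒< odd⇒positive
  ; arc?  = fanArc? λ j → j % 2 ≟ 1
  }

-- The squares are `0, 2i + 1, 2i + 2, 2i + 3` for `i < m`; neighbouring ones share a spoke.
squares : ℕ → Graph
squares m = fromArcs squaresArcs (1 + m * 2)

-- The killer starts opposite the cop, whose every move then leads next to him.
squares-1-killerWin : IsKillerWin (squares 1)
squares-1-killerWin = forced⇒killerWin (squares 1) 1
  (from-yes (Fin.all? λ u → Fin.any? λ v → Graph._~?_ (squares 1) u v))
  (from-yes (Fin.all? λ c → Fin.any? λ k → ¬? (k Fin.≟ c) ×-dec forced? (squares 1) 1 c k))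

squares-2-killerWin : IsKillerWin (squares 2)
squares-2-killerWin = forced⇒killerWin (squares 2) 3
  (from-yes (Fin.all? λ u → Fin.any? λ v → Graph._~?_ (squares 2) u v))
  (from-yes (Fin.all? λ c → Fin.any? λ k → ¬? (k Fin.≟ c) ×-dec forced? (squares 2) 3 c k))

squareCircuit : ∀ {m} → Fin m → Circuit squaresArcs (1 + m * 2) 3
squareCircuit {m} i = record
  { vertex    = window j
  ; bounded   = window-bounded (s≤s (≤-trans (≤-reflexive (+-comm (toℕ i * 2) 2)) (*-monoˡ-≤ 2 (Fin.toℕ<n i))))
  ; injective = λ k k′ _ _ → window-injective (s≤s z≤n) k k′
  ; step      = λ k _ → window-step odd (s≤s z≤n) k
  ; close     = bwd (spoke (trans ([m+n]%n≡m%n j 2) odd))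
  }
  where
  j : ℕ
  j = 1 + toℕ i * 2
  odd : Odd j
  odd = [m+kn]%n≡m%n 1 (toℕ i) 2

square : ∀ m → Fin m → Tour (squares m) 4
square m i = trace squaresArcs (1 + m * 2) (squareCircuit i)

module _ {G : Graph} where
  open Graph G

  Along : Tour G 4 → (a b c d : Vertex) → Set
  Along t a b c d = at 0 ≡ a × at 1 ≡ b × at 2 ≡ c × at 3 ≡ d
    where open Tour t

  along? : ∀ t a b c d → Dec (Along t a b c d)
  along? t a b c d = at 0 Fin.≟ a ×-dec at 1 Fin.≟ b ×-dec at 2 Fin.≟ c ×-dec at 3 Fin.≟ d
    where open Tour t

  along⇒≋ : ∀ s t → (let open Tour t in Along s (at 0) (at 1) (at 2) (at 3)) → s ≋ t
  along⇒≋ s t (p₀ , p₁ , p₂ , p₃) = agree⇒≋ λ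
    { 0 _ → p₀ ; 1 _ → p₁ ; 2 _ → p₂ ; 3 _ → p₃ ; (suc (suc (suc (suc _)))) (s≤s (s≤s (s≤s (s≤s ())))) }

  module _ {m : ℕ} (w : Fin m → Tour G 4) where

    -- Four base points and two directions give the eight parametrisations of a square.
    Traversed : (a b c d : Vertex) → Set
    Traversed a b c d = ∃[ i ] ∃[ r ] (Along (rotate (w i) (toℕ {4} r)) a b c d ⊎
                                       Along (reverse (rotate (w i) (toℕ r))) a b c d)

    traversed? : ∀ a b c d → Dec (Traversed a b c d)
    traversed? a b c d = Fin.any? λ i → Fin.any? λ r →
      along? (rotate (w i) (toℕ r)) a b c d ⊎-dec along? (reverse (rotate (w i) (toℕ r))) a b c d

    -- Adjacent vertices differ, so `a ≢ c` and `b ≢ d` make all four distinct. Each condition comes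
    -- as soon as it can be stated, which prunes the search.
    AllTraversed : Set
    AllTraversed = ∀ a b → a ~ b → ∀ c → b ~ c → a ≢ c → ∀ d → c ~ d → d ~ a → b ≢ d → Traversed a b c d

    allTraversed? : Dec AllTraversed
    allTraversed? = Fin.all? λ a → Fin.all? λ b → (a ~? b) →-dec Fin.all? λ c → (b ~? c) →-dec
      (¬? (a Fin.≟ c) →-dec Fin.all? λ d → (c ~? d) →-dec ((d ~? a) →-dec
      (¬? (b Fin.≟ d) →-dec traversed? a b c d)))

    traversed⇒exhaustive : AllTraversed → ∀ t → ∃[ i ] w i ≋ t
    traversed⇒exhaustive all t with all (at 0) (at 1) (step 0) (at 2) (step 1)
                                        (distinct 0 (s≤s z≤n) (s≤s (s≤s (s≤s z≤n))))
                                        (at 3) (step 2) (subst (at 3 ~_) (periodic 0) (step 3))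
                                        (distinct 1 (s≤s z≤n) (s≤s (s≤s (s≤s z≤n))))
      where open Tour t
    ... | i , r , inj₁ along = i , ≋-trans (≋-sym (rotate-≋ (w i) (toℕ r))) (along⇒≋ (rotate (w i) (toℕ r)) t along)
    ... | i , r , inj₂ along = i , ≋-trans (≋-sym (≋-trans (reverse-≋ (rotate (w i) (toℕ r))) (rotate-≋ (w i) (toℕ r))))
                                           (along⇒≋ (reverse (rotate (w i) (toℕ r))) t along)

squares-cycles : ∀ m → AllTraversed (square m) → HasExactlyCycles (squares m) m 4
squares-cycles m all = hasExactlyCycles (square m)
  (leastPositive-injective (λ i → 1 + toℕ i * 2)
    (λ {i} {j} eq → Fin.toℕ-injective (*-cancelʳ-≡ (toℕ i) (toℕ j) 2 (suc-injective eq)))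
    (λ _ → s≤s z≤n) (square m)
    (λ i → trace-leastPositive squaresArcs (1 + m * 2) (squareCircuit i) 1 (s≤s z≤n) (+-identityʳ _) (window-least _)))
  (traversed⇒exhaustive (square m) all)

squares-1-cycles : HasExactlyCycles (squares 1) 1 4
squares-1-cycles = squares-cycles 1 (from-yes (allTraversed? (square 1)))

squares-2-cycles : HasExactlyCycles (squares 2) 2 4
squares-2-cycles = squares-cycles 2 (from-yes (allTraversed? (square 2)))

-- Assembling the cop-win and killer-win graphs

fan-copWin : ∀ M → IsCopWin (fan (suc M))
fan-copWin M = universal⇒copWin (fan (suc M))
  (λ { zero → suc zero , fwd (spoke (s≤s z≤n)) ; (suc _) → zero , bwd (spoke (s≤s z≤n)) })
  zero (λ { zero v≢0 → contradiction refl v≢0 ; (suc _) _ → fwd (spoke (s≤s z≤n)) })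

-- The eared fan has `M = suc m + (2 + N)`, which is at least 5 exactly when `m + N ≥ 2`; the first
-- three clauses treat the exceptions.
killerWin-cycles : ∀ m N → ¬ (m ≡ 0 × N ≡ 1) →
                   Σ[ G ∈ Graph ] IsKillerWin G × HasExactlyCycles G (suc m) (4 + N)
killerWin-cycles 0 0 _ = squares 1 , squares-1-killerWin , squares-1-cycles
killerWin-cycles 1 0 _ = squares 2 , squares-2-killerWin , squares-2-cycles
killerWin-cycles 0 1 ≢01 = contradiction (refl , refl) ≢01
killerWin-cycles 0 (suc (suc N)) _ =
  eared (5 + N) , eared-killerWin (m≤m+n 5 N) , eared-cycles 0 (2 + N)
killerWin-cycles 1 (suc N) _ =
  eared (5 + N) , eared-killerWin (m≤m+n 5 N) , eared-cycles 1 (1 + N)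
killerWin-cycles (suc (suc m)) N _ =
  eared (3 + m + (2 + N)) ,
  eared-killerWin (s≤s (s≤s (s≤s (≤-trans (m≤m+n 2 N) (m≤n+m (2 + N) m))))) , eared-cycles (2 + m) N

lemma6 : (m n : ℕ) → m ≥ 1 → n ≥ 4 → (m , n) ≢ (1 , 5) →
    (Σ[ G ∈ Graph ] IsCopWin G × HasExactlyCycles G m n) ×
    (Σ[ G ∈ Graph ] IsKillerWin G × HasExactlyCycles G m n)
lemma6 (suc m) (suc (suc (suc (suc N)))) _ (s≤s (s≤s (s≤s (s≤s z≤n)))) ≢15 =
  (fan (suc m + (2 + N)) , fan-copWin (m + (2 + N)) , fan-cycles (suc m) (1 + N)) ,
  killerWin-cycles m N λ { (refl , refl) → ≢15 refl }
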